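{- Let $\mathcal U:\mathbf{Dist}^\bullet\to\mathbf{Set}^{\mathfrak G}$ be the forgetful functor from small distributive categories with chosen finite sums and products to distributive graphs, and let $\mathcal F$ be the construction assigning to each distributive graph $G$ the (syntactically built) distributive category $\mathcal F(G)$. Then $\mathcal F$ is left adjoint to $\mathcal U$.
   Context: Distributive terms are the terms built from constants $0,1$ and a generator $x$ by binary operators $+,\times$; $T$ is the set of all of them, and $\varphi_t$ is the number of occurrences of $x$ in $t\in T$. For a set $A$ and $a_1,\dots,a_{\varphi_t}\in A$, $t[a_1,\dots,a_{\varphi_t}]$ is the expression obtained by substituting $a_i$ for the $i$-th occurrence of $x$; such terms are the distributive expressions on $A$. The category $\mathfrak G$ has objects $\{*\}+T^2$ and, besides identities, for each $\langle t,u\rangle\in T^2$ arrows $d_1,\dots,d_{\varphi_t},c_1,\dots,c_{\varphi_u}:\langle t,u\rangle\to*$. A distributive graph is a functor $G:\mathfrak G\to\mathbf{Set}$; elements of $G(*)$ are its objects, elements $a\in G(\langle t,u\rangle)$ its arcs, with source $t[G(d_1)(a),\dots,G(d_{\varphi_t})(a)]$ and target $u[G(c_1)(a),\dots,G(c_{\varphi_u})(a)]$. Morphisms are natural transformations. $\mathbf{Dist}^\bullet$: small distributive categories (finite sums and products, with $\delta=(\mathbf 1\times\mathrm{inj}_1\mid\mathbf 1\times\mathrm{inj}_2):X\times Y+X\times Z\to X\times(Y+Z)$ invertible) equipped with chosen finite sums and products, and functors strictly preserving the chosen structure. For $\mathfrak D$ in $\mathbf{Dist}^\bullet$, $t^{\mathfrak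 D}[\![X_1,\dots,X_{\varphi_t}]\!]$ is the object of $\mathfrak D$ obtained by interpreting $t[X_1,\dots,X_{\varphi_t}]$ with the chosen structure. $\mathcal U$ is defined by $\mathcal U(\mathfrak D)(*)=|\mathfrak D|$; $\mathcal U(\mathfrak D)(\langle t,u\rangle)=\sum_{X_i,Y_j\in|\mathfrak D|}\mathfrak D(t^{\mathfrak D}[\![X_1,\dots,X_{\varphi_t}]\!],u^{\mathfrak D}[\![Y_1,\dots,Y_{\varphi_u}]\!])$; $\mathcal U(\mathfrak D)(d_i)$ (resp. $\mathcal U(\mathfrak D)(c_j)$) sends an element of the summand indexed by $(X_i),(Y_j)$ to $X_i$ (resp. $Y_j$); and by the obvious action on functors. $\mathcal F(G)$: objects are the distributive expressions on $G(*)$. Arrows are the (well-typed) terms generated by composition $g\circ f$, $(f_1\mid f_2):X_1+X_2\to Y$ for $f_i:X_i\to Y$, and $(f_1,f_2):Y\to X_1\times X_2$ for $f_i:Y\to X_i$, from the constants: each arc $a$ of $G$ (from its source to its target); $\mathbf 1_X:X\to X$, $!_X:\varnothing\to X$, $\mathsf i_X:X\to I$ (with $\varnothing=0$, $I=1$); $\mathrm{proj}_i^{X_1,X_2}:X_1\times X_2\to X_i$, $\mathrm{inj}_i^{X_1,X_2}:X_i\to X_1+X_2$ ($i=1,2$); and $\delta^{ -1}_{X,Y,Z}:X\times(Y+Z)\to X\times Y+X\times Z$; modulo the equations: associativity and unit laws of composition; any $f:\varnothing\to X$ equals $!_X$; any $f:X\to I$ equals $\mathsf i_X$; $\delta^{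 -1}$ is two-sided inverse to $\delta$; $(f_1\mid f_2)\circ\mathrm{inj}_i=f_i$, $f=(f\circ\mathrm{inj}_1\mid f\circ\mathrm{inj}_2)$; $\mathrm{proj}_i\circ(f_1,f_2)=f_i$, $f=(\mathrm{proj}_1\circ f,\mathrm{proj}_2\circ f)$. Its chosen sums and products are given by the term operators $+,\times,0,1$. -}

module Defs where

open import Level using (Level; _⊔_; 0ℓ) renaming (suc to lsuc)
open import Data.Nat.Base using (ℕ; _+_)
open import Data.Fin.Base using (Fin; zero; _↑ˡ_; _↑ʳ_)
open import Data.Product.Base using (_×_; _,_)
open import Data.Unit.Base using (⊤; tt)
open import Function.Base using () renaming (_∘_ to _∘ᶠ_)
open import Function.Bundles using (Func; Inverse)
import Function.Construct.Composition as Compose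
import Function.Construct.Identity as Identity
import Function.Relation.Binary.Setoid.Equality as FuncEq
open import Relation.Binary.Bundles using (Setoid)
open import Relation.Binary.Structures using (IsEquivalence)
open import Relation.Binary.PropositionalEquality.Core as ≡ using (_≡_)
open import Relation.Binary.PropositionalEquality.Properties as ≡ using ()

open Func using (to; cong)

-- As there are no quotient types, "set" means setoid
-- throughout: Set is the category of setoids, and a small category has a
-- setoid of objects and a setoid of arrows.

record Category (o ℓ e : Level) : Set (lsuc (o ⊔ ℓ ⊔ e)) where
  infix  4 _≈_ _⇒_
  infixr 9 _∘_
  field
    Obj     : Set o
    _⇒_     : Obj → Obj → Set ℓ
    _≈_     : ∀ {A B} → A ⇒ B → A ⇒ B → Set e
    ≈-equiv : ∀ {A B} → IsEquivalence (_≈_ {A} {B})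
    id      : ∀ {A} → A ⇒ A
    _∘_     : ∀ {A B C} → B ⇒ C → A ⇒ B → A ⇒ C
    ∘-cong  : ∀ {A B C} {g g′ : B ⇒ C} {f f′ : A ⇒ B} →
              g ≈ g′ → f ≈ f′ → g ∘ f ≈ g′ ∘ f′
    assoc   : ∀ {A B C D} (h : C ⇒ D) (g : B ⇒ C) (f : A ⇒ B) →
              (h ∘ g) ∘ f ≈ h ∘ (g ∘ f)
    idˡ     : ∀ {A B} (f : A ⇒ B) → id ∘ f ≈ f
    idʳ     : ∀ {A B} (f : A ⇒ B) → f ∘ id ≈ f

  hom : Obj → Obj → Setoid ℓ e
  hom A B = record { Carrier = A ⇒ B ; _≈_ = _≈_ ; isEquivalence = ≈-equiv }

record Functor {o ℓ e o′ ℓ′ e′} (C : Category o ℓ e) (D : Category o′ ℓ′ e′)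
       : Set (o ⊔ ℓ ⊔ e ⊔ o′ ⊔ ℓ′ ⊔ e′) where
  private
    module C = Category C
    module D = Category D
  field
    F₀     : C.Obj → D.Obj
    F₁     : ∀ {A B} → A C.⇒ B → F₀ A D.⇒ F₀ B
    F-cong : ∀ {A B} {f g : A C.⇒ B} → f C.≈ g → F₁ f D.≈ F₁ g
    F-id   : ∀ {A} → F₁ (C.id {A}) D.≈ D.id
    F-∘    : ∀ {A B X} (g : B C.⇒ X) (f : A C.⇒ B) →
             F₁ (g C.∘ f) D.≈ F₁ g D.∘ F₁ f

record NaturalTransformation
       {o ℓ e o′ ℓ′ e′} {C : Category o ℓ e} {D : Category o′ ℓ′ e′}
       (F G : Functor C D) : Set (o ⊔ ℓ ⊔ ℓ′ ⊔ e′) where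
  private
    module C = Category C
    module D = Category D
    module F = Functor F
    module G = Functor G
  field
    η       : ∀ A → F.F₀ A D.⇒ G.F₀ A
    natural : ∀ {A B} (f : A C.⇒ B) → η B D.∘ F.F₁ f D.≈ G.F₁ f D.∘ η A

[_,_]ᶜ : ∀ {o ℓ e o′ ℓ′ e′} → Category o ℓ e → Category o′ ℓ′ e′ →
         Category (o ⊔ ℓ ⊔ e ⊔ o′ ⊔ ℓ′ ⊔ e′) (o ⊔ ℓ ⊔ ℓ′ ⊔ e′) (o ⊔ e′)
[ C , D ]ᶜ = record
  { Obj     = Functor C D
  ; _⇒_     = NaturalTransformation
  ; _≈_     = λ α β → ∀ A → η α A D.≈ η β A
  ; ≈-equiv = record
      { refl  = λ A → D≈.refl
      ; sym   = λ p A → D≈.sym (p A)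
      ; trans = λ p q A → D≈.trans (p A) (q A)
      }
  ; id      = record
      { η       = λ A → D.id
      ; natural = λ f → D≈.trans (D.idˡ _) (D≈.sym (D.idʳ _))
      }
  ; _∘_     = λ β α → record
      { η       = λ A → η β A D.∘ η α A
      ; natural = λ f →
          D≈.trans (D.assoc _ _ _)
         (D≈.trans (D.∘-cong D≈.refl (natural α f))
         (D≈.trans (D≈.sym (D.assoc _ _ _))
         (D≈.trans (D.∘-cong (natural β f) D≈.refl)
                   (D.assoc _ _ _))))
      }
  ; ∘-cong  = λ p q A → D.∘-cong (p A) (q A)
  ; assoc   = λ γ β α A → D.assoc _ _ _
  ; idˡ     = λ α A → D.idˡ _
  ; idʳ     = λ α A → D.idʳ _
  }
  where
  module D = Category D
  module D≈ {A B} = IsEquivalence (D.≈-equiv {A} {B})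
  open NaturalTransformation

infix 4 _⊣_

record _⊣_ {o ℓ e o′ ℓ′ e′} {C : Category o ℓ e} {D : Category o′ ℓ′ e′}
       (L : Functor C D) (R : Functor D C)
       : Set (o ⊔ ℓ ⊔ e ⊔ o′ ⊔ ℓ′ ⊔ e′) where
  private
    module C = Category C
    module D = Category D
    module L = Functor L
    module R = Functor R
  field
    transpose : ∀ A X → Inverse (D.hom (L.F₀ A) X) (C.hom A (R.F₀ X))

  ♯ : ∀ {A X} → L.F₀ A D.⇒ X → A C.⇒ R.F₀ X
  ♯ {A} {X} = Inverse.to (transpose A X)

  field
    naturalˡ : ∀ {A B X} (g : L.F₀ B D.⇒ X) (f : A C.⇒ B) →
               ♯ (g D.∘ L.F₁ f) C.≈ ♯ g C.∘ f
    naturalʳ : ∀ {A X Y} (h : X D.⇒ Y) (g : L.F₀ A D.⇒ X) →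
               ♯ (h D.∘ g) C.≈ R.F₁ h C.∘ ♯ g

Setoids : ∀ ℓ → Category (lsuc ℓ) ℓ ℓ
Setoids ℓ = record
  { Obj     = Setoid ℓ ℓ
  ; _⇒_     = Func
  ; _≈_     = λ {A} {B} → FuncEq._≈_ A B
  ; ≈-equiv = λ {A} {B} → FuncEq.isEquivalence A B
  ; id      = λ {A} → Identity.function A
  ; _∘_     = λ g f → Compose.function f g
  ; ∘-cong  = λ {A} {B} {C} {g} p q x →
                Setoid.trans C (cong g (q x)) (p _)
  ; assoc   = λ {A} {B} {C} {D} h g f x → Setoid.refl D
  ; idˡ     = λ {A} {B} f x → Setoid.refl B
  ; idʳ     = λ {A} {B} f x → Setoid.refl B
  }

infixl 6 _⊞_
infixl 7 _⊠_

data Expr {a} (A : Set a) : Set a where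
  𝟎 𝟏     : Expr A
  gen     : A → Expr A
  _⊞_ _⊠_ : Expr A → Expr A → Expr A

T : Set
T = Expr ⊤

pattern x = gen tt

φ : T → ℕ
φ 𝟎       = 0
φ 𝟏       = 0
φ x       = 1
φ (t ⊞ u) = φ t + φ u
φ (t ⊠ u) = φ t + φ u

infix 8 _[_]

_[_] : ∀ {a} {A : Set a} (t : T) → (Fin (φ t) → A) → Expr A
𝟎       [ a ] = 𝟎
𝟏       [ a ] = 𝟏
x       [ a ] = gen (a zero)
(t ⊞ u) [ a ] = t [ a ∘ᶠ (_↑ˡ φ u) ] ⊞ u [ a ∘ᶠ (φ t ↑ʳ_) ]
(t ⊠ u) [ a ] = t [ a ∘ᶠ (_↑ˡ φ u) ] ⊠ u [ a ∘ᶠ (φ t ↑ʳ_) ]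

module _ {ℓ} (S : Setoid ℓ ℓ) where
  private module S = Setoid S

  data ExprEq : Expr S.Carrier → Expr S.Carrier → Set ℓ where
    𝟎   : ExprEq 𝟎 𝟎
    𝟏   : ExprEq 𝟏 𝟏
    gen : ∀ {a b} → a S.≈ b → ExprEq (gen a) (gen b)
    _⊞_ : ∀ {X X′ Y Y′} → ExprEq X X′ → ExprEq Y Y′ → ExprEq (X ⊞ Y) (X′ ⊞ Y′)
    _⊠_ : ∀ {X X′ Y Y′} → ExprEq X X′ → ExprEq Y Y′ → ExprEq (X ⊠ Y) (X′ ⊠ Y′)

  ExprEq-refl : ∀ {X} → ExprEq X X
  ExprEq-refl {𝟎}     = 𝟎
  ExprEq-refl {𝟏}     = 𝟏
  ExprEq-refl {gen a} = gen S.refl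
  ExprEq-refl {X ⊞ Y} = ExprEq-refl ⊞ ExprEq-refl
  ExprEq-refl {X ⊠ Y} = ExprEq-refl ⊠ ExprEq-refl

  ExprEq-sym : ∀ {X Y} → ExprEq X Y → ExprEq Y X
  ExprEq-sym 𝟎       = 𝟎
  ExprEq-sym 𝟏       = 𝟏
  ExprEq-sym (gen p) = gen (S.sym p)
  ExprEq-sym (p ⊞ q) = ExprEq-sym p ⊞ ExprEq-sym q
  ExprEq-sym (p ⊠ q) = ExprEq-sym p ⊠ ExprEq-sym q

  ExprEq-trans : ∀ {X Y Z} → ExprEq X Y → ExprEq Y Z → ExprEq X Z
  ExprEq-trans 𝟎       𝟎         = 𝟎
  ExprEq-trans 𝟏       𝟏         = 𝟏
  ExprEq-trans (gen p) (gen q)   = gen (S.trans p q)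
  ExprEq-trans (p ⊞ q) (p′ ⊞ q′) = ExprEq-trans p p′ ⊞ ExprEq-trans q q′
  ExprEq-trans (p ⊠ q) (p′ ⊠ q′) = ExprEq-trans p p′ ⊠ ExprEq-trans q q′

  ExprEq-equiv : IsEquivalence ExprEq
  ExprEq-equiv = record
    { refl = ExprEq-refl ; sym = ExprEq-sym ; trans = ExprEq-trans }

  []-cong : ∀ t {a b : Fin (φ t) → S.Carrier} → (∀ i → a i S.≈ b i) →
            ExprEq (t [ a ]) (t [ b ])
  []-cong 𝟎       p = 𝟎
  []-cong 𝟏       p = 𝟏
  []-cong x       p = gen (p zero)
  []-cong (t ⊞ u) p = []-cong t (p ∘ᶠ (_↑ˡ φ u)) ⊞ []-cong u (p ∘ᶠ (φ t ↑ʳ_))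
  []-cong (t ⊠ u) p = []-cong t (p ∘ᶠ (_↑ˡ φ u)) ⊠ []-cong u (p ∘ᶠ (φ t ↑ʳ_))

data 𝔊-Obj : Set where
  ⋆     : 𝔊-Obj
  ⟪_,_⟫ : T → T → 𝔊-Obj

data 𝔊-Arr : 𝔊-Obj → 𝔊-Obj → Set where
  idᵍ : ∀ {A} → 𝔊-Arr A A
  d   : ∀ {t u} → Fin (φ t) → 𝔊-Arr ⟪ t , u ⟫ ⋆
  c   : ∀ {t u} → Fin (φ u) → 𝔊-Arr ⟪ t , u ⟫ ⋆

𝔊 : Category 0ℓ 0ℓ 0ℓ
𝔊 = record
  { Obj     = 𝔊-Obj
  ; _⇒_     = 𝔊-Arr
  ; _≈_     = _≡_
  ; ≈-equiv = ≡.isEquivalence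
  ; id      = idᵍ
  ; _∘_     = comp
  ; ∘-cong  = ≡.cong₂ comp
  ; assoc   = comp-assoc
  ; idˡ     = λ f → ≡.refl
  ; idʳ     = comp-idʳ
  }
  where
  comp : ∀ {A B C} → 𝔊-Arr B C → 𝔊-Arr A B → 𝔊-Arr A C
  comp idᵍ   f   = f
  comp (d i) idᵍ = d i
  comp (c j) idᵍ = c j

  comp-assoc : ∀ {A B C D} (h : 𝔊-Arr C D) (g : 𝔊-Arr B C) (f : 𝔊-Arr A B) →
               comp (comp h g) f ≡ comp h (comp g f)
  comp-assoc idᵍ   g   f = ≡.refl
  comp-assoc (d i) idᵍ f = ≡.refl
  comp-assoc (c j) idᵍ f = ≡.refl

  comp-idʳ : ∀ {A B} (f : 𝔊-Arr A B) → comp f idᵍ ≡ f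
  comp-idʳ idᵍ   = ≡.refl
  comp-idʳ (d i) = ≡.refl
  comp-idʳ (c j) = ≡.refl

DistGraphs : ∀ ℓ → Category (lsuc ℓ) ℓ ℓ
DistGraphs ℓ = [ 𝔊 , Setoids ℓ ]ᶜ

DistGraph : ∀ ℓ → Set (lsuc ℓ)
DistGraph ℓ = Category.Obj (DistGraphs ℓ)

module DistGraph {ℓ} (G : DistGraph ℓ) where
  open Functor G using (F₀; F₁) public

  Objects : Setoid ℓ ℓ
  Objects = F₀ ⋆

  Arcs : T → T → Setoid ℓ ℓ
  Arcs t u = F₀ ⟪ t , u ⟫

  source : ∀ {t u} → Setoid.Carrier (Arcs t u) → Expr (Setoid.Carrier Objects)
  source {t} {u} a = t [ (λ i → to (F₁ (d {t} {u} i)) a) ]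

  target : ∀ {t u} → Setoid.Carrier (Arcs t u) → Expr (Setoid.Carrier Objects)
  target {t} {u} a = u [ (λ j → to (F₁ (c {t} {u} j)) a) ]

-- This is a category internal to setoids, with its arrows sorted by domain
-- and codomain.  Equality compares arrows of different hom-types and entails
-- equality of their domains and of their codomains; an arrow A ⇒ B has an
-- equal counterpart in A′ ⇒ B′ whenever A ≃ A′ and B ≃ B′.
record SmallCategory (ℓ : Level) : Set (lsuc ℓ) where
  infix  4 _≃_ _≈_ _⇒_
  infixr 9 _∘_
  field
    Obj     : Set ℓ
    _≃_     : Obj → Obj → Set ℓ
    ≃-equiv : IsEquivalence _≃_

    _⇒_     : Obj → Obj → Set ℓ
    _≈_     : ∀ {A B A′ B′} → A ⇒ B → A′ ⇒ B′ → Set ℓ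
    ≈-refl  : ∀ {A B} {f : A ⇒ B} → f ≈ f
    ≈-sym   : ∀ {A B A′ B′} {f : A ⇒ B} {g : A′ ⇒ B′} → f ≈ g → g ≈ f
    ≈-trans : ∀ {A B A′ B′ A″ B″} {f : A ⇒ B} {g : A′ ⇒ B′} {h : A″ ⇒ B″} →
              f ≈ g → g ≈ h → f ≈ h
    dom-≃   : ∀ {A B A′ B′} {f : A ⇒ B} {g : A′ ⇒ B′} → f ≈ g → A ≃ A′
    cod-≃   : ∀ {A B A′ B′} {f : A ⇒ B} {g : A′ ⇒ B′} → f ≈ g → B ≃ B′
    coe     : ∀ {A B A′ B′} → A ≃ A′ → B ≃ B′ → A ⇒ B → A′ ⇒ B′
    coe-≈   : ∀ {A B A′ B′} (p : A ≃ A′) (q : B ≃ B′) (f : A ⇒ B) →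
              coe p q f ≈ f

    id      : ∀ {A} → A ⇒ A
    id-cong : ∀ {A A′} → A ≃ A′ → id {A} ≈ id {A′}
    _∘_     : ∀ {A B C} → B ⇒ C → A ⇒ B → A ⇒ C
    ∘-cong  : ∀ {A B C A′ B′ C′} {g : B ⇒ C} {g′ : B′ ⇒ C′}
              {f : A ⇒ B} {f′ : A′ ⇒ B′} → g ≈ g′ → f ≈ f′ → g ∘ f ≈ g′ ∘ f′
    assoc   : ∀ {A B C D} (h : C ⇒ D) (g : B ⇒ C) (f : A ⇒ B) →
              (h ∘ g) ∘ f ≈ h ∘ (g ∘ f)
    idˡ     : ∀ {A B} (f : A ⇒ B) → id ∘ f ≈ f
    idʳ     : ∀ {A B} (f : A ⇒ B) → f ∘ id ≈ f

  module ≃ = IsEquivalence ≃-equiv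

  objects : Setoid ℓ ℓ
  objects = record { Carrier = Obj ; _≈_ = _≃_ ; isEquivalence = ≃-equiv }

record ChosenProducts {ℓ} (C : SmallCategory ℓ) : Set ℓ where
  open SmallCategory C
  infixl 7 _⊗_ _⊗₁_
  field
    𝟙        : Obj
    ‼        : ∀ {X} → X ⇒ 𝟙
    ‼-unique : ∀ {X} (f : X ⇒ 𝟙) → f ≈ ‼ {X}

    _⊗_      : Obj → Obj → Obj
    ⊗-cong   : ∀ {A A′ B B′} → A ≃ A′ → B ≃ B′ → A ⊗ B ≃ A′ ⊗ B′
    π₁       : ∀ {A B} → A ⊗ B ⇒ A
    π₂       : ∀ {A B} → A ⊗ B ⇒ B
    π₁-cong  : ∀ {A A′ B B′} → A ≃ A′ → B ≃ B′ → π₁ {A} {B} ≈ π₁ {A′} {B′}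
    π₂-cong  : ∀ {A A′ B B′} → A ≃ A′ → B ≃ B′ → π₂ {A} {B} ≈ π₂ {A′} {B′}
    ⟨_,_⟩    : ∀ {X A B} → X ⇒ A → X ⇒ B → X ⇒ A ⊗ B
    project₁ : ∀ {X A B} (f : X ⇒ A) (g : X ⇒ B) → π₁ ∘ ⟨ f , g ⟩ ≈ f
    project₂ : ∀ {X A B} (f : X ⇒ A) (g : X ⇒ B) → π₂ ∘ ⟨ f , g ⟩ ≈ g
    ⟨⟩-unique : ∀ {X A B} {f : X ⇒ A} {g : X ⇒ B} {h : X ⇒ A ⊗ B} →
                π₁ ∘ h ≈ f → π₂ ∘ h ≈ g → h ≈ ⟨ f , g ⟩

  _⊗₁_ : ∀ {A A′ B B′} → A ⇒ A′ → B ⇒ B′ → A ⊗ B ⇒ A′ ⊗ B′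
  f ⊗₁ g = ⟨ f ∘ π₁ , g ∘ π₂ ⟩

record ChosenSums {ℓ} (C : SmallCategory ℓ) : Set ℓ where
  open SmallCategory C
  infixl 6 _⊕_
  field
    𝟘        : Obj
    ¡        : ∀ {X} → 𝟘 ⇒ X
    ¡-unique : ∀ {X} (f : 𝟘 ⇒ X) → f ≈ ¡ {X}

    _⊕_      : Obj → Obj → Obj
    ⊕-cong   : ∀ {A A′ B B′} → A ≃ A′ → B ≃ B′ → A ⊕ B ≃ A′ ⊕ B′
    ι₁       : ∀ {A B} → A ⇒ A ⊕ B
    ι₂       : ∀ {A B} → B ⇒ A ⊕ B
    ι₁-cong  : ∀ {A A′ B B′} → A ≃ A′ → B ≃ B′ → ι₁ {A} {B} ≈ ι₁ {A′} {B′}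
    ι₂-cong  : ∀ {A A′ B B′} → A ≃ A′ → B ≃ B′ → ι₂ {A} {B} ≈ ι₂ {A′} {B′}
    [_∣_]    : ∀ {A B X} → A ⇒ X → B ⇒ X → A ⊕ B ⇒ X
    inject₁  : ∀ {A B X} (f : A ⇒ X) (g : B ⇒ X) → [ f ∣ g ] ∘ ι₁ ≈ f
    inject₂  : ∀ {A B X} (f : A ⇒ X) (g : B ⇒ X) → [ f ∣ g ] ∘ ι₂ ≈ g
    [∣]-unique : ∀ {A B X} {f : A ⇒ X} {g : B ⇒ X} {h : A ⊕ B ⇒ X} →
                 h ∘ ι₁ ≈ f → h ∘ ι₂ ≈ g → h ≈ [ f ∣ g ]

record DistributiveCategory (ℓ : Level) : Set (lsuc ℓ) where
  field
    category : SmallCategory ℓ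
    products : ChosenProducts category
    sums     : ChosenSums category

  open SmallCategory category public
  open ChosenProducts products public
  open ChosenSums sums public

  δ : ∀ {X Y Z} → X ⊗ Y ⊕ X ⊗ Z ⇒ X ⊗ (Y ⊕ Z)
  δ = [ id ⊗₁ ι₁ ∣ id ⊗₁ ι₂ ]

  field
    δ⁻¹  : ∀ {X Y Z} → X ⊗ (Y ⊕ Z) ⇒ X ⊗ Y ⊕ X ⊗ Z
    δ-δ⁻¹ : ∀ {X Y Z} → δ ∘ δ⁻¹ {X} {Y} {Z} ≈ id {X ⊗ (Y ⊕ Z)}
    δ⁻¹-δ : ∀ {X Y Z} → δ⁻¹ ∘ δ {X} {Y} {Z} ≈ id {X ⊗ Y ⊕ X ⊗ Z}

-- Preservation of ⟨_,_⟩, [_∣_], ‼, ¡ and δ⁻¹ follows by uniqueness.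
record StrictFunctor {ℓ} (D E : DistributiveCategory ℓ) : Set ℓ where
  private
    module D = DistributiveCategory D
    module E = DistributiveCategory E
  field
    F₀      : D.Obj → E.Obj
    F₀-cong : ∀ {A B} → A D.≃ B → F₀ A E.≃ F₀ B
    F₁      : ∀ {A B} → A D.⇒ B → F₀ A E.⇒ F₀ B
    F₁-cong : ∀ {A B A′ B′} {f : A D.⇒ B} {g : A′ D.⇒ B′} →
              f D.≈ g → F₁ f E.≈ F₁ g
    F-id    : ∀ {A} → F₁ (D.id {A}) E.≈ E.id {F₀ A}
    F-∘     : ∀ {A B C} (g : B D.⇒ C) (f : A D.⇒ B) →
              F₁ (g D.∘ f) E.≈ F₁ g E.∘ F₁ f
    F-𝟙     : F₀ D.𝟙 E.≃ E.𝟙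
    F-𝟘     : F₀ D.𝟘 E.≃ E.𝟘
    F-⊗     : ∀ A B → F₀ (A D.⊗ B) E.≃ F₀ A E.⊗ F₀ B
    F-⊕     : ∀ A B → F₀ (A D.⊕ B) E.≃ F₀ A E.⊕ F₀ B
    F-π₁    : ∀ {A B} → F₁ (D.π₁ {A} {B}) E.≈ E.π₁ {F₀ A} {F₀ B}
    F-π₂    : ∀ {A B} → F₁ (D.π₂ {A} {B}) E.≈ E.π₂ {F₀ A} {F₀ B}
    F-ι₁    : ∀ {A B} → F₁ (D.ι₁ {A} {B}) E.≈ E.ι₁ {F₀ A} {F₀ B}
    F-ι₂    : ∀ {A B} → F₁ (D.ι₂ {A} {B}) E.≈ E.ι₂ {F₀ A} {F₀ B}

Dist• : ∀ ℓ → Category (lsuc ℓ) ℓ ℓ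
Dist• ℓ = record
  { Obj     = DistributiveCategory ℓ
  ; _⇒_     = StrictFunctor
  ; _≈_     = _≋_
  ; ≈-equiv = λ {D} {E} → record
      { refl  = ≃.refl E , ≈-refl E
      ; sym   = λ (p , q) → ≃.sym E p , ≈-sym E q
      ; trans = λ (p , q) (p′ , q′) → ≃.trans E p p′ , ≈-trans E q q′
      }
  ; id      = λ {D} → record
      { F₀      = λ A → A
      ; F₀-cong = λ p → p
      ; F₁      = λ f → f
      ; F₁-cong = λ p → p
      ; F-id    = ≈-refl D
      ; F-∘     = λ g f → ≈-refl D
      ; F-𝟙     = ≃.refl D
      ; F-𝟘     = ≃.refl D
      ; F-⊗     = λ A B → ≃.refl D
      ; F-⊕     = λ A B → ≃.refl D
      ; F-π₁    = ≈-refl D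
      ; F-π₂    = ≈-refl D
      ; F-ι₁    = ≈-refl D
      ; F-ι₂    = ≈-refl D
      }
  ; _∘_     = λ {_} {_} {E} K H → record
      { F₀      = λ A → F₀ K (F₀ H A)
      ; F₀-cong = λ p → F₀-cong K (F₀-cong H p)
      ; F₁      = λ f → F₁ K (F₁ H f)
      ; F₁-cong = λ p → F₁-cong K (F₁-cong H p)
      ; F-id    = ≈-trans E (F₁-cong K (F-id H)) (F-id K)
      ; F-∘     = λ g f → ≈-trans E (F₁-cong K (F-∘ H g f)) (F-∘ K _ _)
      ; F-𝟙     = ≃.trans E (F₀-cong K (F-𝟙 H)) (F-𝟙 K)
      ; F-𝟘     = ≃.trans E (F₀-cong K (F-𝟘 H)) (F-𝟘 K)
      ; F-⊗     = λ A B → ≃.trans E (F₀-cong K (F-⊗ H A B)) (F-⊗ K _ _)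
      ; F-⊕     = λ A B → ≃.trans E (F₀-cong K (F-⊕ H A B)) (F-⊕ K _ _)
      ; F-π₁    = ≈-trans E (F₁-cong K (F-π₁ H)) (F-π₁ K)
      ; F-π₂    = ≈-trans E (F₁-cong K (F-π₂ H)) (F-π₂ K)
      ; F-ι₁    = ≈-trans E (F₁-cong K (F-ι₁ H)) (F-ι₁ K)
      ; F-ι₂    = ≈-trans E (F₁-cong K (F-ι₂ H)) (F-ι₂ K)
      }
  ; ∘-cong  = λ {_} {_} {E} {K} (p , q) (p′ , q′) →
                ≃.trans E (F₀-cong K p′) p , ≈-trans E (F₁-cong K q′) q
  ; assoc   = λ {_} {_} {_} {E} _ _ _ → ≃.refl E , ≈-refl E
  ; idˡ     = λ {_} {E} _ → ≃.refl E , ≈-refl E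
  ; idʳ     = λ {_} {E} _ → ≃.refl E , ≈-refl E
  }
  where
  open DistributiveCategory using (≈-refl; ≈-sym; ≈-trans; module ≃)
  open StrictFunctor

  _≋_ : ∀ {D E} → StrictFunctor D E → StrictFunctor D E → Set ℓ
  _≋_ {D} {E} H K =
    (∀ {A} → F₀ H A E.≃ F₀ K A) × (∀ {A B} {f : A D.⇒ B} → F₁ H f E.≈ F₁ K f)
    where
    module D = DistributiveCategory D
    module E = DistributiveCategory E

module _ {ℓ} (D : DistributiveCategory ℓ) where
  open DistributiveCategory D

  ⟦_⟧ : Expr Obj → Obj
  ⟦ 𝟎 ⟧     = 𝟘
  ⟦ 𝟏 ⟧     = 𝟙
  ⟦ gen X ⟧ = X
  ⟦ X ⊞ Y ⟧ = ⟦ X ⟧ ⊕ ⟦ Y ⟧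
  ⟦ X ⊠ Y ⟧ = ⟦ X ⟧ ⊗ ⟦ Y ⟧

  ⟦⟧-cong : ∀ {X Y} → ExprEq objects X Y → ⟦ X ⟧ ≃ ⟦ Y ⟧
  ⟦⟧-cong 𝟎       = ≃.refl
  ⟦⟧-cong 𝟏       = ≃.refl
  ⟦⟧-cong (gen p) = p
  ⟦⟧-cong (p ⊞ q) = ⊕-cong (⟦⟧-cong p) (⟦⟧-cong q)
  ⟦⟧-cong (p ⊠ q) = ⊗-cong (⟦⟧-cong p) (⟦⟧-cong q)

  record 𝓤-Arc (t u : T) : Set ℓ where
    field
      X   : Fin (φ t) → Obj
      Y   : Fin (φ u) → Obj
      arr : ⟦ t [ X ] ⟧ ⇒ ⟦ u [ Y ] ⟧

  record 𝓤-ArcEq {t u : T} (a b : 𝓤-Arc t u) : Set ℓ where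
    private
      module a = 𝓤-Arc a
      module b = 𝓤-Arc b
    field
      X-≃   : ∀ i → a.X i ≃ b.X i
      Y-≃   : ∀ j → a.Y j ≃ b.Y j
      arr-≈ : a.arr ≈ b.arr

  𝓤-Arcs : T → T → Setoid ℓ ℓ
  𝓤-Arcs t u = record
    { Carrier       = 𝓤-Arc t u
    ; _≈_           = 𝓤-ArcEq
    ; isEquivalence = record
        { refl  = record
            { X-≃ = λ i → ≃.refl ; Y-≃ = λ j → ≃.refl ; arr-≈ = ≈-refl }
        ; sym   = λ p → record
            { X-≃   = λ i → ≃.sym (X-≃ p i)
            ; Y-≃   = λ j → ≃.sym (Y-≃ p j)
            ; arr-≈ = ≈-sym (arr-≈ p)
            }
        ; trans = λ p q → record
            { X-≃   = λ i → ≃.trans (X-≃ p i) (X-≃ q i)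
            ; Y-≃   = λ j → ≃.trans (Y-≃ p j) (Y-≃ q j)
            ; arr-≈ = ≈-trans (arr-≈ p) (arr-≈ q)
            }
        }
    }
    where open 𝓤-ArcEq

  𝓤₀ : DistGraph ℓ
  𝓤₀ = record
    { F₀     = ob
    ; F₁     = ar
    ; F-cong = λ {A} {B} {f} → λ { ≡.refl a → Setoid.refl (ob B) }
    ; F-id   = λ {A} a → Setoid.refl (ob A)
    ; F-∘    = ar-∘
    }
    where
    ob : 𝔊-Obj → Setoid ℓ ℓ
    ob ⋆         = objects
    ob ⟪ t , u ⟫ = 𝓤-Arcs t u

    ar : ∀ {A B} → 𝔊-Arr A B → Func (ob A) (ob B)
    ar {A} idᵍ = Identity.function (ob A)
    ar (d i)   = record { to = λ a → 𝓤-Arc.X a i ; cong = λ p → 𝓤-ArcEq.X-≃ p i }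
    ar (c j)   = record { to = λ a → 𝓤-Arc.Y a j ; cong = λ p → 𝓤-ArcEq.Y-≃ p j }

    module 𝔊 = Category 𝔊

    ar-∘ : ∀ {A B C} (g : 𝔊-Arr B C) (f : 𝔊-Arr A B) (a : Setoid.Carrier (ob A)) →
           Setoid._≈_ (ob C) (to (ar (g 𝔊.∘ f)) a) (to (ar g) (to (ar f) a))
    ar-∘ {C = C} idᵍ f   a = Setoid.refl (ob C)
    ar-∘ (d i)       idᵍ a = ≃.refl
    ar-∘ (c j)       idᵍ a = ≃.refl

module _ {ℓ} {D E : DistributiveCategory ℓ} (H : StrictFunctor D E) where
  private
    module D = DistributiveCategory D
    module E = DistributiveCategory E
    open StrictFunctor H

  F-⟦⟧ : ∀ t (X : Fin (φ t) → D.Obj) →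
         F₀ (⟦ D ⟧ (t [ X ])) E.≃ ⟦ E ⟧ (t [ (λ i → F₀ (X i)) ])
  F-⟦⟧ 𝟎       X = F-𝟘
  F-⟦⟧ 𝟏       X = F-𝟙
  F-⟦⟧ x       X = E.≃.refl
  F-⟦⟧ (t ⊞ u) X = E.≃.trans (F-⊕ _ _) (E.⊕-cong (F-⟦⟧ t _) (F-⟦⟧ u _))
  F-⟦⟧ (t ⊠ u) X = E.≃.trans (F-⊗ _ _) (E.⊗-cong (F-⟦⟧ t _) (F-⟦⟧ u _))

  𝓤-arc : ∀ {t u} → 𝓤-Arc D t u → 𝓤-Arc E t u
  𝓤-arc {t} {u} a = record
    { X   = λ i → F₀ (X i)
    ; Y   = λ j → F₀ (Y j)
    ; arr = E.coe (F-⟦⟧ t X) (F-⟦⟧ u Y) (F₁ arr)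
    }
    where open 𝓤-Arc a

  𝓤₁ : NaturalTransformation (𝓤₀ D) (𝓤₀ E)
  𝓤₁ = record { η = comp ; natural = nat }
    where
    open Functor
    comp : ∀ A → Func (F₀ (𝓤₀ D) A) (F₀ (𝓤₀ E) A)
    comp ⋆         = record { to = StrictFunctor.F₀ H ; cong = F₀-cong }
    comp ⟪ t , u ⟫ = record
      { to   = 𝓤-arc
      ; cong = λ p → record
          { X-≃   = λ i → F₀-cong (𝓤-ArcEq.X-≃ p i)
          ; Y-≃   = λ j → F₀-cong (𝓤-ArcEq.Y-≃ p j)
          ; arr-≈ = E.≈-trans (E.coe-≈ _ _ _)
                   (E.≈-trans (F₁-cong (𝓤-ArcEq.arr-≈ p))
                              (E.≈-sym (E.coe-≈ _ _ _)))
          }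
      }

    nat : ∀ {A B} (f : 𝔊-Arr A B) (a : Setoid.Carrier (F₀ (𝓤₀ D) A)) →
          Setoid._≈_ (F₀ (𝓤₀ E) B)
            (to (comp B) (to (F₁ (𝓤₀ D) f) a))
            (to (F₁ (𝓤₀ E) f) (to (comp A) a))
    nat {A} idᵍ a = Setoid.refl (F₀ (𝓤₀ E) A)
    nat (d i)   a = E.≃.refl
    nat (c j)   a = E.≃.refl

𝓤 : ∀ {ℓ} → Functor (Dist• ℓ) (DistGraphs ℓ)
𝓤 = record
  { F₀     = 𝓤₀
  ; F₁     = 𝓤₁
  ; F-cong = λ {D} {E} {H} {K} (p , q) → λ where
      ⋆         X → p
      ⟪ t , u ⟫ a → record
        { X-≃   = λ i → p
        ; Y-≃   = λ j → p
        ; arr-≈ = ≈-trans E (coe-≈ E _ _ _)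
                 (≈-trans E q (≈-sym E (coe-≈ E _ _ _)))
        }
  ; F-id   = λ {D} → λ where
      ⋆         X → ≃.refl D
      ⟪ t , u ⟫ a → record
        { X-≃   = λ i → ≃.refl D
        ; Y-≃   = λ j → ≃.refl D
        ; arr-≈ = coe-≈ D _ _ _
        }
  ; F-∘    = λ {_} {D} {E} K H → λ where
      ⋆         X → ≃.refl E
      ⟪ t , u ⟫ a → record
        { X-≃   = λ i → ≃.refl E
        ; Y-≃   = λ j → ≃.refl E
        ; arr-≈ = ≈-trans E (coe-≈ E _ _ _)
                 (≈-sym E (≈-trans E (coe-≈ E _ _ _)
                          (StrictFunctor.F₁-cong K (coe-≈ D _ _ _))))
        }
  }
  where
  open DistributiveCategory using (≈-sym; ≈-trans; coe-≈; module ≃)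

module Free {ℓ} (G : DistGraph ℓ) where
  open DistGraph G
  open Setoid Objects using () renaming (Carrier to G⋆)

  infix  4 _≃_ _⟶_ _≈_
  infixr 9 _∘_

  _≃_ : Expr G⋆ → Expr G⋆ → Set ℓ
  _≃_ = ExprEq Objects

  -- The conversion coe exists only because equal objects need not be
  -- identical; it is identified with doing nothing (coe-≈).
  data _⟶_ : Expr G⋆ → Expr G⋆ → Set ℓ where
    arc     : ∀ {t u} (a : Setoid.Carrier (Arcs t u)) → source a ⟶ target a
    id      : ∀ {X} → X ⟶ X
    ¡       : ∀ {X} → 𝟎 ⟶ X
    ‼       : ∀ {X} → X ⟶ 𝟏
    π₁      : ∀ {X Y} → X ⊠ Y ⟶ X
    π₂      : ∀ {X Y} → X ⊠ Y ⟶ Y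
    ι₁      : ∀ {X Y} → X ⟶ X ⊞ Y
    ι₂      : ∀ {X Y} → Y ⟶ X ⊞ Y
    δ⁻¹     : ∀ {X Y Z} → X ⊠ (Y ⊞ Z) ⟶ X ⊠ Y ⊞ X ⊠ Z
    _∘_     : ∀ {X Y Z} → Y ⟶ Z → X ⟶ Y → X ⟶ Z
    [_∣_]   : ∀ {X Y Z} → X ⟶ Z → Y ⟶ Z → X ⊞ Y ⟶ Z
    ⟨_,_⟩   : ∀ {X Y Z} → Z ⟶ X → Z ⟶ Y → Z ⟶ X ⊠ Y
    coe     : ∀ {X X′ Y Y′} → X ≃ X′ → Y ≃ Y′ → X ⟶ Y → X′ ⟶ Y′

  δ : ∀ {X Y Z} → X ⊠ Y ⊞ X ⊠ Z ⟶ X ⊠ (Y ⊞ Z)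
  δ = [ ⟨ id ∘ π₁ , ι₁ ∘ π₂ ⟩ ∣ ⟨ id ∘ π₁ , ι₂ ∘ π₂ ⟩ ]

  data _≈_ : ∀ {X Y X′ Y′} → X ⟶ Y → X′ ⟶ Y′ → Set ℓ where
    ≈-refl   : ∀ {X Y} {f : X ⟶ Y} → f ≈ f
    ≈-sym    : ∀ {X Y X′ Y′} {f : X ⟶ Y} {g : X′ ⟶ Y′} → f ≈ g → g ≈ f
    ≈-trans  : ∀ {X Y X′ Y′ X″ Y″} {f : X ⟶ Y} {g : X′ ⟶ Y′} {h : X″ ⟶ Y″} →
               f ≈ g → g ≈ h → f ≈ h
    coe-≈    : ∀ {X X′ Y Y′} (p : X ≃ X′) (q : Y ≃ Y′) (f : X ⟶ Y) → coe p q f ≈ f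

    arc-cong : ∀ {t u} {a b : Setoid.Carrier (Arcs t u)} →
               Setoid._≈_ (Arcs t u) a b → arc {t} {u} a ≈ arc {t} {u} b
    id-cong  : ∀ {X X′} → X ≃ X′ → id {X} ≈ id {X′}
    ¡-cong   : ∀ {X X′} → X ≃ X′ → ¡ {X} ≈ ¡ {X′}
    ‼-cong   : ∀ {X X′} → X ≃ X′ → ‼ {X} ≈ ‼ {X′}
    π₁-cong  : ∀ {X X′ Y Y′} → X ≃ X′ → Y ≃ Y′ → π₁ {X} {Y} ≈ π₁ {X′} {Y′}
    π₂-cong  : ∀ {X X′ Y Y′} → X ≃ X′ → Y ≃ Y′ → π₂ {X} {Y} ≈ π₂ {X′} {Y′}
    ι₁-cong  : ∀ {X X′ Y Y′} → X ≃ X′ → Y ≃ Y′ → ι₁ {X} {Y} ≈ ι₁ {X′} {Y′}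
    ι₂-cong  : ∀ {X X′ Y Y′} → X ≃ X′ → Y ≃ Y′ → ι₂ {X} {Y} ≈ ι₂ {X′} {Y′}
    δ⁻¹-cong : ∀ {X X′ Y Y′ Z Z′} → X ≃ X′ → Y ≃ Y′ → Z ≃ Z′ →
               δ⁻¹ {X} {Y} {Z} ≈ δ⁻¹ {X′} {Y′} {Z′}
    ∘-cong   : ∀ {X Y Z X′ Y′ Z′} {g : Y ⟶ Z} {g′ : Y′ ⟶ Z′}
               {f : X ⟶ Y} {f′ : X′ ⟶ Y′} → g ≈ g′ → f ≈ f′ → g ∘ f ≈ g′ ∘ f′
    [∣]-cong : ∀ {X Y Z X′ Y′ Z′} {f : X ⟶ Z} {f′ : X′ ⟶ Z′}
               {g : Y ⟶ Z} {g′ : Y′ ⟶ Z′} →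
               f ≈ f′ → g ≈ g′ → [ f ∣ g ] ≈ [ f′ ∣ g′ ]
    ⟨⟩-cong  : ∀ {X Y Z X′ Y′ Z′} {f : Z ⟶ X} {f′ : Z′ ⟶ X′}
               {g : Z ⟶ Y} {g′ : Z′ ⟶ Y′} →
               f ≈ f′ → g ≈ g′ → ⟨ f , g ⟩ ≈ ⟨ f′ , g′ ⟩

    assoc    : ∀ {X Y Z W} (h : Z ⟶ W) (g : Y ⟶ Z) (f : X ⟶ Y) →
               (h ∘ g) ∘ f ≈ h ∘ (g ∘ f)
    idˡ      : ∀ {X Y} (f : X ⟶ Y) → id ∘ f ≈ f
    idʳ      : ∀ {X Y} (f : X ⟶ Y) → f ∘ id ≈ f
    ¡-unique : ∀ {X} (f : 𝟎 ⟶ X) → f ≈ ¡ {X}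
    ‼-unique : ∀ {X} (f : X ⟶ 𝟏) → f ≈ ‼ {X}
    δ-δ⁻¹    : ∀ {X Y Z} → δ ∘ δ⁻¹ {X} {Y} {Z} ≈ id {X ⊠ (Y ⊞ Z)}
    δ⁻¹-δ    : ∀ {X Y Z} → δ⁻¹ ∘ δ {X} {Y} {Z} ≈ id {X ⊠ Y ⊞ X ⊠ Z}
    inject₁  : ∀ {X Y Z} (f : X ⟶ Z) (g : Y ⟶ Z) → [ f ∣ g ] ∘ ι₁ ≈ f
    inject₂  : ∀ {X Y Z} (f : X ⟶ Z) (g : Y ⟶ Z) → [ f ∣ g ] ∘ ι₂ ≈ g
    [∣]-η    : ∀ {X Y Z} (f : X ⊞ Y ⟶ Z) → f ≈ [ f ∘ ι₁ ∣ f ∘ ι₂ ]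
    project₁ : ∀ {X Y Z} (f : Z ⟶ X) (g : Z ⟶ Y) → π₁ ∘ ⟨ f , g ⟩ ≈ f
    project₂ : ∀ {X Y Z} (f : Z ⟶ X) (g : Z ⟶ Y) → π₂ ∘ ⟨ f , g ⟩ ≈ g
    ⟨⟩-η     : ∀ {X Y Z} (f : Z ⟶ X ⊠ Y) → f ≈ ⟨ π₁ ∘ f , π₂ ∘ f ⟩

  ≃-refl : ∀ {X} → X ≃ X
  ≃-refl = ExprEq-refl Objects

  dom-≃ : ∀ {X Y X′ Y′} {f : X ⟶ Y} {g : X′ ⟶ Y′} → f ≈ g → X ≃ X′
  cod-≃ : ∀ {X Y X′ Y′} {f : X ⟶ Y} {g : X′ ⟶ Y′} → f ≈ g → Y ≃ Y′

  dom-≃ ≈-refl             = ≃-refl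
  dom-≃ (≈-sym p)          = ExprEq-sym Objects (dom-≃ p)
  dom-≃ (≈-trans p q)      = ExprEq-trans Objects (dom-≃ p) (dom-≃ q)
  dom-≃ (coe-≈ p q f)      = ExprEq-sym Objects p
  dom-≃ (arc-cong {t} {u} p) = []-cong Objects t (λ i → cong (F₁ (d {t} {u} i)) p)
  dom-≃ (id-cong p)        = p
  dom-≃ (¡-cong p)         = 𝟎
  dom-≃ (‼-cong p)         = p
  dom-≃ (π₁-cong p q)      = p ⊠ q
  dom-≃ (π₂-cong p q)      = p ⊠ q
  dom-≃ (ι₁-cong p q)      = p
  dom-≃ (ι₂-cong p q)      = q
  dom-≃ (δ⁻¹-cong p q r)   = p ⊠ (q ⊞ r)
  dom-≃ (∘-cong p q)       = dom-≃ q
  dom-≃ ([∣]-cong p q)     = dom-≃ p ⊞ dom-≃ q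
  dom-≃ (⟨⟩-cong p q)      = dom-≃ p
  dom-≃ (assoc h g f)      = ≃-refl
  dom-≃ (idˡ f)            = ≃-refl
  dom-≃ (idʳ f)            = ≃-refl
  dom-≃ (¡-unique f)       = ≃-refl
  dom-≃ (‼-unique f)       = ≃-refl
  dom-≃ δ-δ⁻¹              = ≃-refl
  dom-≃ δ⁻¹-δ              = ≃-refl
  dom-≃ (inject₁ f g)      = ≃-refl
  dom-≃ (inject₂ f g)      = ≃-refl
  dom-≃ ([∣]-η f)          = ≃-refl
  dom-≃ (project₁ f g)     = ≃-refl
  dom-≃ (project₂ f g)     = ≃-refl
  dom-≃ (⟨⟩-η f)           = ≃-refl

  cod-≃ ≈-refl             = ≃-refl
  cod-≃ (≈-sym p)          = ExprEq-sym Objects (cod-≃ p)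
  cod-≃ (≈-trans p q)      = ExprEq-trans Objects (cod-≃ p) (cod-≃ q)
  cod-≃ (coe-≈ p q f)      = ExprEq-sym Objects q
  cod-≃ (arc-cong {t} {u} p) = []-cong Objects u (λ j → cong (F₁ (c {t} {u} j)) p)
  cod-≃ (id-cong p)        = p
  cod-≃ (¡-cong p)         = p
  cod-≃ (‼-cong p)         = 𝟏
  cod-≃ (π₁-cong p q)      = p
  cod-≃ (π₂-cong p q)      = q
  cod-≃ (ι₁-cong p q)      = p ⊞ q
  cod-≃ (ι₂-cong p q)      = p ⊞ q
  cod-≃ (δ⁻¹-cong p q r)   = p ⊠ q ⊞ p ⊠ r
  cod-≃ (∘-cong p q)       = cod-≃ p
  cod-≃ ([∣]-cong p q)     = cod-≃ p
  cod-≃ (⟨⟩-cong p q)      = cod-≃ p ⊠ cod-≃ q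
  cod-≃ (assoc h g f)      = ≃-refl
  cod-≃ (idˡ f)            = ≃-refl
  cod-≃ (idʳ f)            = ≃-refl
  cod-≃ (¡-unique f)       = ≃-refl
  cod-≃ (‼-unique f)       = ≃-refl
  cod-≃ δ-δ⁻¹              = ≃-refl
  cod-≃ δ⁻¹-δ              = ≃-refl
  cod-≃ (inject₁ f g)      = ≃-refl
  cod-≃ (inject₂ f g)      = ≃-refl
  cod-≃ ([∣]-η f)          = ≃-refl
  cod-≃ (project₁ f g)     = ≃-refl
  cod-≃ (project₂ f g)     = ≃-refl
  cod-≃ (⟨⟩-η f)           = ≃-refl

𝓕 : ∀ {ℓ} → DistGraph ℓ → DistributiveCategory ℓ
𝓕 G = record
  { category = record
      { Obj     = Expr (Setoid.Carrier Objects)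
      ; _≃_     = _≃_
      ; ≃-equiv = ExprEq-equiv Objects
      ; _⇒_     = _⟶_
      ; _≈_     = _≈_
      ; ≈-refl  = ≈-refl
      ; ≈-sym   = ≈-sym
      ; ≈-trans = ≈-trans
      ; dom-≃   = dom-≃
      ; cod-≃   = cod-≃
      ; coe     = coe
      ; coe-≈   = coe-≈
      ; id      = id
      ; id-cong = id-cong
      ; _∘_     = _∘_
      ; ∘-cong  = ∘-cong
      ; assoc   = assoc
      ; idˡ     = idˡ
      ; idʳ     = idʳ
      }
  ; products = record
      { 𝟙         = 𝟏
      ; ‼         = ‼
      ; ‼-unique  = ‼-unique
      ; _⊗_       = _⊠_
      ; ⊗-cong    = _⊠_
      ; π₁        = π₁
      ; π₂        = π₂
      ; π₁-cong   = π₁-cong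
      ; π₂-cong   = π₂-cong
      ; ⟨_,_⟩     = ⟨_,_⟩
      ; project₁  = project₁
      ; project₂  = project₂
      ; ⟨⟩-unique = λ p q → ≈-trans (⟨⟩-η _) (⟨⟩-cong p q)
      }
  ; sums = record
      { 𝟘          = 𝟎
      ; ¡          = ¡
      ; ¡-unique   = ¡-unique
      ; _⊕_        = _⊞_
      ; ⊕-cong     = _⊞_
      ; ι₁         = ι₁
      ; ι₂         = ι₂
      ; ι₁-cong    = ι₁-cong
      ; ι₂-cong    = ι₂-cong
      ; [_∣_]      = [_∣_]
      ; inject₁    = inject₁
      ; inject₂    = inject₂
      ; [∣]-unique = λ p q → ≈-trans ([∣]-η _) ([∣]-cong p q)
      }
  ; δ⁻¹   = δ⁻¹
  ; δ-δ⁻¹ = δ-δ⁻¹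
  ; δ⁻¹-δ = δ⁻¹-δ
  }
  where
  open DistGraph G using (Objects)
  open Free G

{-# OPTIONS --safe #-}

-- The terms of 𝓕(G) are the raw operations of a distributive category, so a
-- graph morphism α : G → 𝓤(D) extends to 𝓕(G) by structural recursion, and
-- respects the equations because they hold in D.  A strict functor preserves
-- each operation, if need be by uniqueness, so it is determined on terms by its
-- values on generators and arcs; hence the inclusion G → 𝓤(𝓕(G)) is a
-- universal arrow from G to 𝓤.

module Submission where

open import Data.Fin.Base using (Fin; zero)
open import Data.Product.Base using (Σ-syntax; _×_; _,_)
open import Function.Base using () renaming (_∘_ to _∘ᶠ_)
open import Function.Bundles using (Func)
open import Level using (Level)
open import Relation.Binary.Bundles using (Setoid)
open import Relation.Binary.PropositionalEquality.Core using (_≡_; refl)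
open import Relation.Binary.Structures using (IsEquivalence)
open import Defs

open Func using (to; cong)

-- Left adjoints from universal arrows.

module _ {o ℓ e o′ ℓ′ e′} {C : Category o ℓ e} {D : Category o′ ℓ′ e′} (R : Functor D C) where
  private
    module C = Category C
    module D = Category D
    module R = Functor R
    module C≈ {A B} = IsEquivalence (C.≈-equiv {A} {B})
    module D≈ {A B} = IsEquivalence (D.≈-equiv {A} {B})

  module UniversalArrows
    (L₀         : C.Obj → D.Obj)
    (unit       : ∀ A → A C.⇒ R.F₀ (L₀ A))
    (ext        : ∀ {A X} → A C.⇒ R.F₀ X → L₀ A D.⇒ X)
    (ext-unit   : ∀ {A X} (f : A C.⇒ R.F₀ X) → R.F₁ (ext f) C.∘ unit A C.≈ f)
    (ext-unique : ∀ {A X} (f : A C.⇒ R.F₀ X) (g : L₀ A D.⇒ X) →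
                  R.F₁ g C.∘ unit A C.≈ f → g D.≈ ext f) where

    -- This is naturality of the transpose in its target variable.
    R∘-unit : ∀ {A X Y} (h : X D.⇒ Y) (g : L₀ A D.⇒ X) →
              R.F₁ (h D.∘ g) C.∘ unit A C.≈ R.F₁ h C.∘ (R.F₁ g C.∘ unit A)
    R∘-unit h g = C≈.trans (C.∘-cong (R.F-∘ h g) C≈.refl) (C.assoc _ _ _)

    R∘-ext : ∀ {A X Y} (h : X D.⇒ Y) (f : A C.⇒ R.F₀ X) →
             R.F₁ (h D.∘ ext f) C.∘ unit A C.≈ R.F₁ h C.∘ f
    R∘-ext h f = C≈.trans (R∘-unit h _) (C.∘-cong C≈.refl (ext-unit f))

    ext-cong : ∀ {A X} {f g : A C.⇒ R.F₀ X} → f C.≈ g → ext f D.≈ ext g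
    ext-cong {f = f} {g} p = ext-unique g (ext f) (C≈.trans (ext-unit f) p)

    -- Each functor law compares two arrows with the same restriction along `unit`, so uniqueness
    -- settles it. The object part is literally `L₀`, which is why `refl` proves the object equation
    -- for `𝓕`.
    L : Functor C D
    L = record
      { F₀     = L₀
      ; F₁     = λ f → ext (unit _ C.∘ f)
      ; F-cong = λ p → ext-cong (C.∘-cong C≈.refl p)
      ; F-id   = D≈.sym (ext-unique _ _
                   (C≈.trans (C.∘-cong R.F-id C≈.refl)
                   (C≈.trans (C.idˡ _) (C≈.sym (C.idʳ _)))))
      ; F-∘    = λ g f → D≈.sym (ext-unique _ _
                   (C≈.trans (R∘-ext _ _)
                   (C≈.trans (C≈.sym (C.assoc _ _ _))
                   (C≈.trans (C.∘-cong (ext-unit _) C≈.refl) (C.assoc _ _ _)))))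
      }

    L⊣R : L ⊣ R
    L⊣R = record
      { transpose = λ A X → record
          { to        = λ g → R.F₁ g C.∘ unit A
          ; from      = ext
          ; to-cong   = λ p → C.∘-cong (R.F-cong p) C≈.refl
          ; from-cong = ext-cong
          ; inverse   =
                (λ {f} p → C≈.trans (C.∘-cong (R.F-cong p) C≈.refl) (ext-unit f))
              , (λ {g} p → D≈.sym (ext-unique _ g (C≈.sym p)))
          }
      ; naturalˡ  = λ g f → C≈.trans (R∘-ext g _) (C≈.sym (C.assoc _ _ _))
      ; naturalʳ  = R∘-unit
      }

-- Derived congruences in a distributive category.

-- In the congruences below the two sides have different types; the left-hand
-- side is transported by coe before a uniqueness property is applied to it.
module Congruences {ℓ} (D : DistributiveCategory ℓ) where
  open DistributiveCategory D

  ¡-cong : ∀ {X X′} → X ≃ X′ → ¡ {X} ≈ ¡ {X′}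
  ¡-cong p = ≈-trans (≈-sym (coe-≈ ≃.refl p ¡)) (¡-unique _)

  ‼-cong : ∀ {X X′} → X ≃ X′ → ‼ {X} ≈ ‼ {X′}
  ‼-cong p = ≈-trans (≈-sym (coe-≈ p ≃.refl ‼)) (‼-unique _)

  -- As `π₁ ∘ h` need not be well typed, the hypotheses quantify over all `h′` of the right type
  -- equal to `h`; callers need not know which transport is taken.
  ⟨⟩-unique′ : ∀ {X A B X′ P} {f : X ⇒ A} {g : X ⇒ B} (h : X′ ⇒ P) →
               X′ ≃ X → P ≃ A ⊗ B →
               (∀ {h′ : X ⇒ A ⊗ B} → h′ ≈ h → π₁ ∘ h′ ≈ f) →
               (∀ {h′ : X ⇒ A ⊗ B} → h′ ≈ h → π₂ ∘ h′ ≈ g) →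
               h ≈ ⟨ f , g ⟩
  ⟨⟩-unique′ h p q eq₁ eq₂ =
    ≈-trans (≈-sym (coe-≈ p q h)) (⟨⟩-unique (eq₁ (coe-≈ p q h)) (eq₂ (coe-≈ p q h)))

  [∣]-unique′ : ∀ {X A B X′ S} {f : A ⇒ X} {g : B ⇒ X} (h : S ⇒ X′) →
                S ≃ A ⊕ B → X′ ≃ X →
                (∀ {h′ : A ⊕ B ⇒ X} → h′ ≈ h → h′ ∘ ι₁ ≈ f) →
                (∀ {h′ : A ⊕ B ⇒ X} → h′ ≈ h → h′ ∘ ι₂ ≈ g) →
                h ≈ [ f ∣ g ]
  [∣]-unique′ h p q eq₁ eq₂ =
    ≈-trans (≈-sym (coe-≈ p q h)) ([∣]-unique (eq₁ (coe-≈ p q h)) (eq₂ (coe-≈ p q h)))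

  ⟨⟩-cong : ∀ {X A B X′ A′ B′} {f : X ⇒ A} {f′ : X′ ⇒ A′} {g : X ⇒ B} {g′ : X′ ⇒ B′} →
            f ≈ f′ → g ≈ g′ → ⟨ f , g ⟩ ≈ ⟨ f′ , g′ ⟩
  ⟨⟩-cong {f = f} {g = g} p q = ⟨⟩-unique′ ⟨ f , g ⟩ (dom-≃ p) (⊗-cong A≃A′ B≃B′)
    -- The projection from the primed product is moved back to the unprimed one, where `project₁`
    -- computes.
    (λ r → ≈-trans (∘-cong (π₁-cong (≃.sym A≃A′) (≃.sym B≃B′)) r) (≈-trans (project₁ f g) p))
    (λ r → ≈-trans (∘-cong (π₂-cong (≃.sym A≃A′) (≃.sym B≃B′)) r) (≈-trans (project₂ f g) q))
    where
    A≃A′ = cod-≃ p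
    B≃B′ = cod-≃ q

  [∣]-cong : ∀ {X A B X′ A′ B′} {f : A ⇒ X} {f′ : A′ ⇒ X′} {g : B ⇒ X} {g′ : B′ ⇒ X′} →
             f ≈ f′ → g ≈ g′ → [ f ∣ g ] ≈ [ f′ ∣ g′ ]
  [∣]-cong {f = f} {g = g} p q = [∣]-unique′ [ f ∣ g ] (⊕-cong A≃A′ B≃B′) (cod-≃ p)
    (λ r → ≈-trans (∘-cong r (ι₁-cong (≃.sym A≃A′) (≃.sym B≃B′))) (≈-trans (inject₁ f g) p))
    (λ r → ≈-trans (∘-cong r (ι₂-cong (≃.sym A≃A′) (≃.sym B≃B′))) (≈-trans (inject₂ f g) q))
    where
    A≃A′ = dom-≃ p
    B≃B′ = dom-≃ q

  δ-cong : ∀ {X X′ Y Y′ Z Z′} → X ≃ X′ → Y ≃ Y′ → Z ≃ Z′ →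
           δ {X} {Y} {Z} ≈ δ {X′} {Y′} {Z′}
  δ-cong p q r = [∣]-cong
    (⟨⟩-cong (∘-cong (id-cong p) (π₁-cong p q)) (∘-cong (ι₁-cong q r) (π₂-cong p q)))
    (⟨⟩-cong (∘-cong (id-cong p) (π₁-cong p r)) (∘-cong (ι₂-cong q r) (π₂-cong p r)))

  -- A section of `δ` is its inverse: `h = (δ⁻¹ ∘ δ) ∘ h = δ⁻¹ ∘ (δ ∘ h) = δ⁻¹`. Thus only one
  -- inverse law has to be checked when the lemma is applied.
  δ⁻¹-unique : ∀ {X Y Z A B} (h : A ⇒ B) → A ≃ X ⊗ (Y ⊕ Z) → B ≃ X ⊗ Y ⊕ X ⊗ Z →
               (∀ {h′ : X ⊗ (Y ⊕ Z) ⇒ X ⊗ Y ⊕ X ⊗ Z} → h′ ≈ h → δ ∘ h′ ≈ id {X ⊗ (Y ⊕ Z)}) →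
               h ≈ δ⁻¹ {X} {Y} {Z}
  δ⁻¹-unique h p q eq =
    ≈-trans (≈-sym (coe-≈ p q h))
   (≈-trans (≈-sym (idˡ _))
   (≈-trans (∘-cong (≈-sym δ⁻¹-δ) ≈-refl)
   (≈-trans (assoc _ _ _)
   (≈-trans (∘-cong ≈-refl (eq (coe-≈ p q h))) (idʳ _)))))

  δ⁻¹-cong : ∀ {X X′ Y Y′ Z Z′} → X ≃ X′ → Y ≃ Y′ → Z ≃ Z′ →
             δ⁻¹ {X} {Y} {Z} ≈ δ⁻¹ {X′} {Y′} {Z′}
  δ⁻¹-cong p q r = δ⁻¹-unique δ⁻¹ dom≃ (⊕-cong (⊗-cong p q) (⊗-cong p r))
    (λ s → ≈-trans (∘-cong (δ-cong (≃.sym p) (≃.sym q) (≃.sym r)) s)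
          (≈-trans δ-δ⁻¹ (id-cong dom≃)))
    where dom≃ = ⊗-cong p (⊕-cong q r)

-- Strict functors and the mediating arrows.

module StrictPreservation {ℓ} {D E : DistributiveCategory ℓ} (H : StrictFunctor D E) where
  open StrictFunctor H
  private
    module D = DistributiveCategory D
  open DistributiveCategory E
  open Congruences E

  preserves-¡ : ∀ {X} → F₁ (D.¡ {X}) ≈ ¡ {F₀ X}
  preserves-¡ = ≈-trans (≈-sym (coe-≈ F-𝟘 ≃.refl _)) (¡-unique _)

  preserves-‼ : ∀ {X} → F₁ (D.‼ {X}) ≈ ‼ {F₀ X}
  preserves-‼ = ≈-trans (≈-sym (coe-≈ ≃.refl F-𝟙 _)) (‼-unique _)

  -- Since `H` preserves projections and composition, the image of the pairing has components `F₁ f`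
  -- and `F₁ g`, and uniqueness in `E` applies.
  preserves-⟨⟩ : ∀ {X A B} (f : X D.⇒ A) (g : X D.⇒ B) → F₁ D.⟨ f , g ⟩ ≈ ⟨ F₁ f , F₁ g ⟩
  preserves-⟨⟩ f g = ⟨⟩-unique′ _ ≃.refl (F-⊗ _ _)
    (λ r → ≈-trans (∘-cong (≈-sym F-π₁) r)
          (≈-trans (≈-sym (F-∘ _ _)) (F₁-cong (D.project₁ f g))))
    (λ r → ≈-trans (∘-cong (≈-sym F-π₂) r)
          (≈-trans (≈-sym (F-∘ _ _)) (F₁-cong (D.project₂ f g))))

  preserves-[∣] : ∀ {X A B} (f : A D.⇒ X) (g : B D.⇒ X) → F₁ D.[ f ∣ g ] ≈ [ F₁ f ∣ F₁ g ]
  preserves-[∣] f g = [∣]-unique′ _ (F-⊕ _ _) ≃.refl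
    (λ r → ≈-trans (∘-cong r (≈-sym F-ι₁))
          (≈-trans (≈-sym (F-∘ _ _)) (F₁-cong (D.inject₁ f g))))
    (λ r → ≈-trans (∘-cong r (≈-sym F-ι₂))
          (≈-trans (≈-sym (F-∘ _ _)) (F₁-cong (D.inject₂ f g))))

  preserves-id⊗₁ : ∀ {X Y Z} (g : Y D.⇒ Z) → F₁ (D.id {X} D.⊗₁ g) ≈ id {F₀ X} ⊗₁ F₁ g
  preserves-id⊗₁ g = ≈-trans (preserves-⟨⟩ _ _)
    (⟨⟩-cong (≈-trans (F-∘ _ _) (∘-cong F-id F-π₁))
             (≈-trans (F-∘ _ _) (∘-cong ≈-refl F-π₂)))

  preserves-δ : ∀ {X Y Z} → F₁ (D.δ {X} {Y} {Z}) ≈ δ {F₀ X} {F₀ Y} {F₀ Z}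
  preserves-δ = ≈-trans (preserves-[∣] _ _)
    ([∣]-cong (≈-trans (preserves-id⊗₁ _) (⟨⟩-cong ≈-refl (∘-cong F-ι₁ ≈-refl)))
              (≈-trans (preserves-id⊗₁ _) (⟨⟩-cong ≈-refl (∘-cong F-ι₂ ≈-refl))))

  -- Applying `H` to `δ ∘ δ⁻¹ = id` and using preservation of `δ` exhibits the image of `δ⁻¹` as a
  -- section of `δ`.
  preserves-δ⁻¹ : ∀ {X Y Z} → F₁ (D.δ⁻¹ {X} {Y} {Z}) ≈ δ⁻¹ {F₀ X} {F₀ Y} {F₀ Z}
  preserves-δ⁻¹ = δ⁻¹-unique _ dom≃
    (≃.trans (F-⊕ _ _) (⊕-cong (F-⊗ _ _) (F-⊗ _ _)))
    (λ r → ≈-trans (∘-cong (≈-sym preserves-δ) r)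
          (≈-trans (≈-sym (F-∘ _ _))
          (≈-trans (F₁-cong D.δ-δ⁻¹) (≈-trans F-id (id-cong dom≃)))))
    where dom≃ = ≃.trans (F-⊗ _ _) (⊗-cong ≃.refl (F-⊕ _ _))

-- The inclusion of a graph into its free distributive category.

module _ {ℓ} (G : DistGraph ℓ) where
  private
    module G = DistGraph G
    module F = Free G

  -- The chosen structure of `𝓕 G` is the term operators themselves, but neither side reduces for a
  -- variable `t`, hence the induction. It supplies the transport that retypes an arc as an element
  -- of `𝓤₀ (𝓕 G)`.
  t[gen] : ∀ t (a : Fin (φ t) → Setoid.Carrier G.Objects) →
           t [ a ] F.≃ ⟦ 𝓕 G ⟧ (t [ gen ∘ᶠ a ])
  t[gen] 𝟎       a = 𝟎
  t[gen] 𝟏       a = 𝟏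
  t[gen] x       a = F.≃-refl
  t[gen] (t ⊞ u) a = t[gen] t _ ⊞ t[gen] u _
  t[gen] (t ⊠ u) a = t[gen] t _ ⊠ t[gen] u _

  unit : NaturalTransformation G (𝓤₀ (𝓕 G))
  unit = record { η = comp ; natural = nat }
    where
    open Functor
    comp : ∀ A → Func (F₀ G A) (F₀ (𝓤₀ (𝓕 G)) A)
    comp ⋆         = record { to = gen ; cong = gen }
    comp ⟪ t , u ⟫ = record
      { to   = λ a → record
          { X   = λ i → gen (to (F₁ G (d i)) a)
          ; Y   = λ j → gen (to (F₁ G (c j)) a)
          ; arr = F.coe (t[gen] t _) (t[gen] u _) (F.arc {t} {u} a)
          }
      ; cong = λ p → record
          { X-≃   = λ i → gen (cong (F₁ G (d i)) p)
          ; Y-≃   = λ j → gen (cong (F₁ G (c j)) p)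
          ; arr-≈ = F.≈-trans (F.coe-≈ _ _ _)
                   (F.≈-trans (F.arc-cong p) (F.≈-sym (F.coe-≈ _ _ _)))
          }
      }

    nat : ∀ {A B} (f : 𝔊-Arr A B) (a : Setoid.Carrier (F₀ G A)) →
          Setoid._≈_ (F₀ (𝓤₀ (𝓕 G)) B)
            (to (comp B) (to (F₁ G f) a)) (to (F₁ (𝓤₀ (𝓕 G)) f) (to (comp A) a))
    nat {A} idᵍ a = cong (comp A) (F-id G a)
    nat (d i)   a = F.≃-refl
    nat (c j)   a = F.≃-refl

-- Interpretation of terms along a graph morphism.

module Extension {ℓ} {G : DistGraph ℓ} {D : DistributiveCategory ℓ}
                 (α : NaturalTransformation G (𝓤₀ D)) where
  private
    module G = DistGraph G
    module F = Free G
    module α = NaturalTransformation α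
  open DistributiveCategory D
  open Congruences D

  ⟦_⟧₀ : Expr (Setoid.Carrier G.Objects) → Obj
  ⟦ 𝟎 ⟧₀     = 𝟘
  ⟦ 𝟏 ⟧₀     = 𝟙
  ⟦ gen a ⟧₀ = to (α.η ⋆) a
  ⟦ X ⊞ Y ⟧₀ = ⟦ X ⟧₀ ⊕ ⟦ Y ⟧₀
  ⟦ X ⊠ Y ⟧₀ = ⟦ X ⟧₀ ⊗ ⟦ Y ⟧₀

  ⟦⟧₀-cong : ∀ {X Y} → X F.≃ Y → ⟦ X ⟧₀ ≃ ⟦ Y ⟧₀
  ⟦⟧₀-cong 𝟎       = ≃.refl
  ⟦⟧₀-cong 𝟏       = ≃.refl
  ⟦⟧₀-cong (gen p) = cong (α.η ⋆) p
  ⟦⟧₀-cong (p ⊞ q) = ⊕-cong (⟦⟧₀-cong p) (⟦⟧₀-cong q)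
  ⟦⟧₀-cong (p ⊠ q) = ⊗-cong (⟦⟧₀-cong p) (⟦⟧₀-cong q)

  -- The family `X` is separate from the images of `a` because naturality of `α` relates the two
  -- only up to `≃`.
  ⟦t[]⟧₀ : ∀ t {a : Fin (φ t) → Setoid.Carrier G.Objects} {X : Fin (φ t) → Obj} →
           (∀ i → to (α.η ⋆) (a i) ≃ X i) → ⟦ t [ a ] ⟧₀ ≃ ⟦ D ⟧ (t [ X ])
  ⟦t[]⟧₀ 𝟎       p = ≃.refl
  ⟦t[]⟧₀ 𝟏       p = ≃.refl
  ⟦t[]⟧₀ x       p = p zero
  ⟦t[]⟧₀ (t ⊞ u) p = ⊕-cong (⟦t[]⟧₀ t (p ∘ᶠ _)) (⟦t[]⟧₀ u (p ∘ᶠ _))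
  ⟦t[]⟧₀ (t ⊠ u) p = ⊗-cong (⟦t[]⟧₀ t (p ∘ᶠ _)) (⟦t[]⟧₀ u (p ∘ᶠ _))

  ⟦_⟧₁ : ∀ {X Y} → X F.⟶ Y → ⟦ X ⟧₀ ⇒ ⟦ Y ⟧₀
  ⟦ F.arc {t} {u} a ⟧₁ =
    -- Naturality at `d i` and `c j` matches the endpoints of the image arc with the images of the
    -- endpoints of `a`.
    coe (≃.sym (⟦t[]⟧₀ t (λ i → α.natural (d i) a)))
        (≃.sym (⟦t[]⟧₀ u (λ j → α.natural (c j) a)))
        (𝓤-Arc.arr (to (α.η ⟪ t , u ⟫) a))
  ⟦ F.id ⟧₁        = id
  ⟦ F.¡ ⟧₁         = ¡
  ⟦ F.‼ ⟧₁         = ‼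
  ⟦ F.π₁ ⟧₁        = π₁
  ⟦ F.π₂ ⟧₁        = π₂
  ⟦ F.ι₁ ⟧₁        = ι₁
  ⟦ F.ι₂ ⟧₁        = ι₂
  ⟦ F.δ⁻¹ ⟧₁       = δ⁻¹
  ⟦ g F.∘ f ⟧₁     = ⟦ g ⟧₁ ∘ ⟦ f ⟧₁
  ⟦ F.[ f ∣ g ] ⟧₁ = [ ⟦ f ⟧₁ ∣ ⟦ g ⟧₁ ]
  ⟦ F.⟨ f , g ⟩ ⟧₁ = ⟨ ⟦ f ⟧₁ , ⟦ g ⟧₁ ⟩
  ⟦ F.coe p q f ⟧₁ = coe (⟦⟧₀-cong p) (⟦⟧₀-cong q) ⟦ f ⟧₁

  -- Soundness of the equations: most are fields of `D`, and the congruences for mediating arrows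
  -- and `δ⁻¹` come from `Congruences D`.
  ⟦⟧₁-cong : ∀ {X Y X′ Y′} {f : X F.⟶ Y} {g : X′ F.⟶ Y′} → f F.≈ g → ⟦ f ⟧₁ ≈ ⟦ g ⟧₁
  ⟦⟧₁-cong F.≈-refl           = ≈-refl
  ⟦⟧₁-cong (F.≈-sym p)        = ≈-sym (⟦⟧₁-cong p)
  ⟦⟧₁-cong (F.≈-trans p q)    = ≈-trans (⟦⟧₁-cong p) (⟦⟧₁-cong q)
  ⟦⟧₁-cong (F.coe-≈ p q f)    = coe-≈ _ _ _
  ⟦⟧₁-cong (F.arc-cong {t} {u} p) =
    ≈-trans (coe-≈ _ _ _)
   (≈-trans (𝓤-ArcEq.arr-≈ (cong (α.η ⟪ t , u ⟫) p)) (≈-sym (coe-≈ _ _ _)))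
  ⟦⟧₁-cong (F.id-cong p)      = id-cong (⟦⟧₀-cong p)
  ⟦⟧₁-cong (F.¡-cong p)       = ¡-cong (⟦⟧₀-cong p)
  ⟦⟧₁-cong (F.‼-cong p)       = ‼-cong (⟦⟧₀-cong p)
  ⟦⟧₁-cong (F.π₁-cong p q)    = π₁-cong (⟦⟧₀-cong p) (⟦⟧₀-cong q)
  ⟦⟧₁-cong (F.π₂-cong p q)    = π₂-cong (⟦⟧₀-cong p) (⟦⟧₀-cong q)
  ⟦⟧₁-cong (F.ι₁-cong p q)    = ι₁-cong (⟦⟧₀-cong p) (⟦⟧₀-cong q)
  ⟦⟧₁-cong (F.ι₂-cong p q)    = ι₂-cong (⟦⟧₀-cong p) (⟦⟧₀-cong q)
  ⟦⟧₁-cong (F.δ⁻¹-cong p q r) = δ⁻¹-cong (⟦⟧₀-cong p) (⟦⟧₀-cong q) (⟦⟧₀-cong r)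
  ⟦⟧₁-cong (F.∘-cong p q)     = ∘-cong (⟦⟧₁-cong p) (⟦⟧₁-cong q)
  ⟦⟧₁-cong (F.[∣]-cong p q)   = [∣]-cong (⟦⟧₁-cong p) (⟦⟧₁-cong q)
  ⟦⟧₁-cong (F.⟨⟩-cong p q)    = ⟨⟩-cong (⟦⟧₁-cong p) (⟦⟧₁-cong q)
  ⟦⟧₁-cong (F.assoc h g f)    = assoc _ _ _
  ⟦⟧₁-cong (F.idˡ f)          = idˡ _
  ⟦⟧₁-cong (F.idʳ f)          = idʳ _
  ⟦⟧₁-cong (F.¡-unique f)     = ¡-unique _
  ⟦⟧₁-cong (F.‼-unique f)     = ‼-unique _
  ⟦⟧₁-cong F.δ-δ⁻¹            = δ-δ⁻¹
  ⟦⟧₁-cong F.δ⁻¹-δ            = δ⁻¹-δ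
  ⟦⟧₁-cong (F.inject₁ f g)    = inject₁ _ _
  ⟦⟧₁-cong (F.inject₂ f g)    = inject₂ _ _
  -- The eta rule is uniqueness applied to the arrow's own restrictions.
  ⟦⟧₁-cong (F.[∣]-η f)        = [∣]-unique ≈-refl ≈-refl
  ⟦⟧₁-cong (F.project₁ f g)   = project₁ _ _
  ⟦⟧₁-cong (F.project₂ f g)   = project₂ _ _
  ⟦⟧₁-cong (F.⟨⟩-η f)         = ⟨⟩-unique ≈-refl ≈-refl

  extend : StrictFunctor (𝓕 G) D
  extend = record
    { F₀      = ⟦_⟧₀
    ; F₀-cong = ⟦⟧₀-cong
    ; F₁      = ⟦_⟧₁
    ; F₁-cong = ⟦⟧₁-cong
    ; F-id    = ≈-refl
    ; F-∘     = λ g f → ≈-refl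
    ; F-𝟙     = ≃.refl
    ; F-𝟘     = ≃.refl
    ; F-⊗     = λ X Y → ≃.refl
    ; F-⊕     = λ X Y → ≃.refl
    ; F-π₁    = ≈-refl
    ; F-π₂    = ≈-refl
    ; F-ι₁    = ≈-refl
    ; F-ι₂    = ≈-refl
    }

  extend-unit : Category._≈_ (DistGraphs ℓ)
                  (Category._∘_ (DistGraphs ℓ) (𝓤₁ extend) (unit G)) α
  extend-unit ⋆         a = ≃.refl
  extend-unit ⟪ t , u ⟫ a = record
    { X-≃   = λ i → α.natural (d i) a
    ; Y-≃   = λ j → α.natural (c j) a
    -- The three transports come from `𝓤₁`, from the interpreted `F.coe` in `unit`, and from the
    -- interpretation of `F.arc`.
    ; arr-≈ = ≈-trans (coe-≈ _ _ _) (≈-trans (coe-≈ _ _ _) (coe-≈ _ _ _))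
    }

  -- Uniqueness of the extension.

  module _ (H : StrictFunctor (𝓕 G) D)
           (H-unit : Category._≈_ (DistGraphs ℓ)
                       (Category._∘_ (DistGraphs ℓ) (𝓤₁ H) (unit G)) α) where
    open StrictFunctor H
    open StrictPreservation H

    unique₀ : ∀ X → F₀ X ≃ ⟦ X ⟧₀
    unique₀ 𝟎       = F-𝟘
    unique₀ 𝟏       = F-𝟙
    unique₀ (gen a) = H-unit ⋆ a
    unique₀ (X ⊞ Y) = ≃.trans (F-⊕ X Y) (⊕-cong (unique₀ X) (unique₀ Y))
    unique₀ (X ⊠ Y) = ≃.trans (F-⊗ X Y) (⊗-cong (unique₀ X) (unique₀ Y))

    -- Preservation by `H` yields the structure of `D` at the objects `F₀ X`; congruence along
    -- `unique₀` then moves it to `⟦ X ⟧₀`.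
    unique₁ : ∀ {X Y} (f : X F.⟶ Y) → F₁ f ≈ ⟦ f ⟧₁
    unique₁ (F.arc {t} {u} a) =
      -- The transports made by `unit` and by `𝓤₁ H` are put back first, so that `H-unit` applies to
      -- the arc.
      ≈-trans (F₁-cong (F.≈-sym (F.coe-≈ _ _ _)))
     (≈-trans (≈-sym (coe-≈ _ _ _))
     (≈-trans (𝓤-ArcEq.arr-≈ (H-unit ⟪ t , u ⟫ a)) (≈-sym (coe-≈ _ _ _))))
    unique₁ F.id          = ≈-trans F-id (id-cong (unique₀ _))
    unique₁ F.¡           = ≈-trans preserves-¡ (¡-cong (unique₀ _))
    unique₁ F.‼           = ≈-trans preserves-‼ (‼-cong (unique₀ _))
    unique₁ F.π₁          = ≈-trans F-π₁ (π₁-cong (unique₀ _) (unique₀ _))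
    unique₁ F.π₂          = ≈-trans F-π₂ (π₂-cong (unique₀ _) (unique₀ _))
    unique₁ F.ι₁          = ≈-trans F-ι₁ (ι₁-cong (unique₀ _) (unique₀ _))
    unique₁ F.ι₂          = ≈-trans F-ι₂ (ι₂-cong (unique₀ _) (unique₀ _))
    unique₁ F.δ⁻¹         = ≈-trans preserves-δ⁻¹ (δ⁻¹-cong (unique₀ _) (unique₀ _) (unique₀ _))
    unique₁ (g F.∘ f)     = ≈-trans (F-∘ g f) (∘-cong (unique₁ g) (unique₁ f))
    unique₁ F.[ f ∣ g ]   = ≈-trans (preserves-[∣] f g) ([∣]-cong (unique₁ f) (unique₁ g))
    unique₁ F.⟨ f , g ⟩   = ≈-trans (preserves-⟨⟩ f g) (⟨⟩-cong (unique₁ f) (unique₁ g))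
    unique₁ (F.coe p q f) =
      ≈-trans (F₁-cong (F.coe-≈ p q f)) (≈-trans (unique₁ f) (≈-sym (coe-≈ _ _ _)))

    extend-unique : Category._≈_ (Dist• ℓ) H extend
    extend-unique = unique₀ _ , unique₁ _

theorem15 : ∀ (ℓ : Level) →
    Σ[ F ∈ Functor (DistGraphs ℓ) (Dist• ℓ) ]
    ((∀ G → Functor.F₀ F G ≡ 𝓕 G) × F ⊣ 𝓤)
theorem15 ℓ = L , (λ G → refl) , L⊣R
  where
  open UniversalArrows (𝓤 {ℓ}) 𝓕 unit Extension.extend Extension.extend-unit
                       Extension.extend-unique
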